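{- $f(321)\ge 333$. Consequently, Borsuk's conjecture fails in every dimension $n\ge 321$, i.e. $f(n)>n+1$ for all $n\ge 321$.
   Context: For $n\ge 1$, $f(n)$ denotes the smallest integer $f$ such that every bounded set in $\mathbb{R}^n$ can be partitioned into at most $f$ subsets each of strictly smaller diameter than the original set. Borsuk's conjecture asserts $f(n)=n+1$ for all $n\ge1$. (It is known from prior work that $f(n)>n+1$ for all $n\ge 323$.) -}

module Defs where

open import Data.Fin.Base using (Fin)
open import Data.Nat.Base as ℕ using (ℕ; _⊔_)
import Data.Nat.Properties as ℕ
open import Data.Product.Base using (Σ; ∃; _×_; _,_)
open import Data.Rational.Base as ℚ using (ℚ; 0ℚ; 1ℚ; ½; ∣_∣; NonZero; Positive)
import Data.Rational.Properties as ℚ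
open import Data.Rational.Solver using (module +-*-Solver)
open import Data.Vec.Functional using (Vector; foldr)
open import Relation.Binary.PropositionalEquality using (_≡_; refl; sym; trans; cong; subst)

------------------------------------------------------------------------
-- Real numbers: Cauchy sequences of rationals, with equality _≈_.

IsCauchy : (ℕ → ℚ) → Set
IsCauchy u = ∀ ε → 0ℚ ℚ.< ε →
  ∃ λ N → ∀ m n → N ℕ.≤ m → N ℕ.≤ n → ∣ u m ℚ.- u n ∣ ℚ.< ε

record ℝ : Set where
  constructor mkℝ
  field
    seq    : ℕ → ℚ
    cauchy : IsCauchy seq

open ℝ public

infix  4 _≈_ _≤_ _<_
infixl 6 _+_ _-_
infixl 7 _*_
infix  8 -_

record _≈_ (x y : ℝ) : Set where
  constructor mk≈
  field
    close : ∀ ε → 0ℚ ℚ.< ε →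
            ∃ λ N → ∀ n → N ℕ.≤ n → ∣ seq x n ℚ.- seq y n ∣ ℚ.< ε

record _≤_ (x y : ℝ) : Set where
  constructor mk≤
  field
    below : ∀ ε → 0ℚ ℚ.< ε →
            ∃ λ N → ∀ n → N ℕ.≤ n → seq x n ℚ.< seq y n ℚ.+ ε

record _<_ (x y : ℝ) : Set where
  constructor mk<
  field
    gap      : ℚ
    positive : 0ℚ ℚ.< gap
    below    : ∃ λ N → ∀ n → N ℕ.≤ n → seq x n ℚ.+ gap ℚ.< seq y n

-- The moduli of convergence are kept abstract because unfolding them makes type
-- checking of everything below extremely slow; the sequences still compute.
abstract
  private
    pos* : ∀ {p q} → 0ℚ ℚ.< p → 0ℚ ℚ.< q → 0ℚ ℚ.< p ℚ.* q
    pos* {p} {q} 0<p 0<q =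
      ℚ.positive⁻¹ (p ℚ.* q) {{ℚ.pos*pos⇒pos p {{ℚ.positive 0<p}} q {{ℚ.positive 0<q}}}}

    half+half : ∀ ε → ½ ℚ.* ε ℚ.+ ½ ℚ.* ε ≡ ε
    half+half = solve 1 (λ e → con ½ :* e :+ con ½ :* e := e) refl
      where open +-*-Solver

    sum-diff : ∀ a b c d → (a ℚ.+ b) ℚ.- (c ℚ.+ d) ≡ (a ℚ.- c) ℚ.+ (b ℚ.- d)
    sum-diff = solve 4 (λ a b c d → (a :+ b) :- (c :+ d) := (a :- c) :+ (b :- d)) refl
      where open +-*-Solver

    prod-diff : ∀ a b c d → a ℚ.* b ℚ.- c ℚ.* d ≡ a ℚ.* (b ℚ.- d) ℚ.+ d ℚ.* (a ℚ.- c)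
    prod-diff = solve 4 (λ a b c d → a :* b :- c :* d := a :* (b :- d) :+ d :* (a :- c)) refl
      where open +-*-Solver

    neg-diff : ∀ a b → (ℚ.- a) ℚ.- (ℚ.- b) ≡ ℚ.- (a ℚ.- b)
    neg-diff = solve 2 (λ a b → (:- a) :- (:- b) := :- (a :- b)) refl
      where open +-*-Solver

    split : ∀ a b → a ≡ b ℚ.+ (a ℚ.- b)
    split = solve 2 (λ a b → a := b :+ (a :- b)) refl
      where open +-*-Solver

    eventuallyBounded : (u : ℕ → ℚ) → IsCauchy u → ∃ λ B → 0ℚ ℚ.< B ×
      ∃ λ N → ∀ n → N ℕ.≤ n → ∣ u n ∣ ℚ.≤ B
    eventuallyBounded u u-cauchy with u-cauchy 1ℚ (ℚ.positive⁻¹ 1ℚ)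
    ... | N , close = ∣ u N ∣ ℚ.+ 1ℚ
                    , ℚ.+-mono-≤-< (ℚ.0≤∣p∣ (u N)) (ℚ.positive⁻¹ 1ℚ)
                    , N , bound
      where
      open ℚ.≤-Reasoning
      bound : ∀ n → N ℕ.≤ n → ∣ u n ∣ ℚ.≤ ∣ u N ∣ ℚ.+ 1ℚ
      bound n N≤n = begin
        ∣ u n ∣                              ≡⟨ cong ∣_∣ (split (u n) (u N)) ⟩
        ∣ u N ℚ.+ (u n ℚ.- u N) ∣     ≤⟨ ℚ.∣p+q∣≤∣p∣+∣q∣ (u N) _ ⟩
        ∣ u N ∣ ℚ.+ ∣ u n ℚ.- u N ∣   ≤⟨ ℚ.+-monoʳ-≤ ∣ u N ∣ (ℚ.<⇒≤ (close n N N≤n ℕ.≤-refl)) ⟩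
        ∣ u N ∣ ℚ.+ 1ℚ                       ∎

    scale : ∀ B C ε → 0ℚ ℚ.< B → 0ℚ ℚ.< C → 0ℚ ℚ.< ε →
            ∃ λ δ → 0ℚ ℚ.< δ × B ℚ.* δ ℚ.+ C ℚ.* δ ≡ ε
    scale B C ε 0<B 0<C 0<ε = r ℚ.* ε , pos* {r} {ε} 0<r 0<ε , eq
      where
      B+C-pos : Positive (B ℚ.+ C)
      B+C-pos = ℚ.pos+pos⇒pos B {{ℚ.positive 0<B}} C {{ℚ.positive 0<C}}

      B+C-nonZero : NonZero (B ℚ.+ C)
      B+C-nonZero = ℚ.pos⇒nonZero (B ℚ.+ C) {{B+C-pos}}

      r : ℚ
      r = ℚ.1/_ (B ℚ.+ C) {{B+C-nonZero}}

      0<r : 0ℚ ℚ.< r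
      0<r = ℚ.positive⁻¹ r {{ℚ.1/pos⇒pos (B ℚ.+ C) {{B+C-pos}}}}

      eq : B ℚ.* (r ℚ.* ε) ℚ.+ C ℚ.* (r ℚ.* ε) ≡ ε
      eq = trans (sym (ℚ.*-distribʳ-+ (r ℚ.* ε) B C))
          (trans (sym (ℚ.*-assoc (B ℚ.+ C) r ε))
          (trans (cong (ℚ._* ε) (ℚ.*-inverseʳ (B ℚ.+ C) {{B+C-nonZero}}))
                 (ℚ.*-identityˡ ε)))

    prod< : ∀ D δ a b → 0ℚ ℚ.< D → ∣ a ∣ ℚ.≤ D → ∣ b ∣ ℚ.< δ → ∣ a ℚ.* b ∣ ℚ.< D ℚ.* δ
    prod< D δ a b 0<D ∣a∣≤D ∣b∣<δ = begin-strict
      ∣ a ℚ.* b ∣      ≡⟨ ℚ.∣p*q∣≡∣p∣*∣q∣ a b ⟩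
      ∣ a ∣ ℚ.* ∣ b ∣  ≤⟨ ℚ.*-monoʳ-≤-nonNeg ∣ b ∣ {{ℚ.nonNegative (ℚ.0≤∣p∣ b)}} ∣a∣≤D ⟩
      D ℚ.* ∣ b ∣      <⟨ ℚ.*-monoʳ-<-pos D {{ℚ.positive 0<D}} ∣b∣<δ ⟩
      D ℚ.* δ          ∎
      where open ℚ.≤-Reasoning

    prod-close : ∀ B C δ a b c d → 0ℚ ℚ.< B → 0ℚ ℚ.< C → ∣ a ∣ ℚ.≤ B → ∣ d ∣ ℚ.≤ C →
                 ∣ a ℚ.- c ∣ ℚ.< δ → ∣ b ℚ.- d ∣ ℚ.< δ →
                 ∣ a ℚ.* b ℚ.- c ℚ.* d ∣ ℚ.< B ℚ.* δ ℚ.+ C ℚ.* δ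
    prod-close B C δ a b c d 0<B 0<C ∣a∣≤B ∣d∣≤C a~c b~d = begin-strict
      ∣ a ℚ.* b ℚ.- c ℚ.* d ∣
        ≡⟨ cong ∣_∣ (prod-diff a b c d) ⟩
      ∣ a ℚ.* (b ℚ.- d) ℚ.+ d ℚ.* (a ℚ.- c) ∣
        ≤⟨ ℚ.∣p+q∣≤∣p∣+∣q∣ (a ℚ.* (b ℚ.- d)) (d ℚ.* (a ℚ.- c)) ⟩
      ∣ a ℚ.* (b ℚ.- d) ∣ ℚ.+ ∣ d ℚ.* (a ℚ.- c) ∣
        <⟨ ℚ.+-mono-< (prod< B δ a (b ℚ.- d) 0<B ∣a∣≤B b~d)
                      (prod< C δ d (a ℚ.- c) 0<C ∣d∣≤C a~c) ⟩
      B ℚ.* δ ℚ.+ C ℚ.* δ ∎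
      where open ℚ.≤-Reasoning

  const-cauchy : ∀ q → IsCauchy (λ _ → q)
  const-cauchy q ε 0<ε =
    0 , λ _ _ _ _ → subst (ℚ._< ε) (sym (cong ∣_∣ (ℚ.+-inverseʳ q))) 0<ε

  +-cauchy : ∀ u v → IsCauchy u → IsCauchy v → IsCauchy (λ n → u n ℚ.+ v n)
  +-cauchy u v u-cauchy v-cauchy ε 0<ε
    with u-cauchy (½ ℚ.* ε) (pos* (ℚ.positive⁻¹ ½) 0<ε)
       | v-cauchy (½ ℚ.* ε) (pos* (ℚ.positive⁻¹ ½) 0<ε)
  ... | M , p | N , q = M ⊔ N , λ m n M⊔N≤m M⊔N≤n → begin-strict
    ∣ (u m ℚ.+ v m) ℚ.- (u n ℚ.+ v n) ∣
      ≡⟨ cong ∣_∣ (sum-diff (u m) (v m) (u n) (v n)) ⟩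
    ∣ (u m ℚ.- u n) ℚ.+ (v m ℚ.- v n) ∣
      ≤⟨ ℚ.∣p+q∣≤∣p∣+∣q∣ (u m ℚ.- u n) (v m ℚ.- v n) ⟩
    ∣ u m ℚ.- u n ∣ ℚ.+ ∣ v m ℚ.- v n ∣
      <⟨ ℚ.+-mono-< (p m n (ℕ.m⊔n≤o⇒m≤o M N M⊔N≤m) (ℕ.m⊔n≤o⇒m≤o M N M⊔N≤n))
                    (q m n (ℕ.m⊔n≤o⇒n≤o M N M⊔N≤m) (ℕ.m⊔n≤o⇒n≤o M N M⊔N≤n)) ⟩
    ½ ℚ.* ε ℚ.+ ½ ℚ.* ε
      ≡⟨ half+half ε ⟩
    ε ∎
    where open ℚ.≤-Reasoning

  neg-cauchy : ∀ u → IsCauchy u → IsCauchy (λ n → ℚ.- u n)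
  neg-cauchy u u-cauchy ε 0<ε with u-cauchy ε 0<ε
  ... | N , p = N , λ m n N≤m N≤n → begin-strict
    ∣ (ℚ.- u m) ℚ.- (ℚ.- u n) ∣  ≡⟨ cong ∣_∣ (neg-diff (u m) (u n)) ⟩
    ∣ ℚ.- (u m ℚ.- u n) ∣        ≡⟨ ℚ.∣-p∣≡∣p∣ (u m ℚ.- u n) ⟩
    ∣ u m ℚ.- u n ∣              <⟨ p m n N≤m N≤n ⟩
    ε                            ∎
    where open ℚ.≤-Reasoning

  *-cauchy : ∀ u v → IsCauchy u → IsCauchy v → IsCauchy (λ n → u n ℚ.* v n)
  *-cauchy u v u-cauchy v-cauchy ε 0<ε =
    fromBounds (eventuallyBounded u u-cauchy) (eventuallyBounded v v-cauchy)
    where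
    Goal : Set
    Goal = ∃ λ N → ∀ m n → N ℕ.≤ m → N ℕ.≤ n → ∣ u m ℚ.* v m ℚ.- u n ℚ.* v n ∣ ℚ.< ε

    fromModuli : ∀ B C δ → 0ℚ ℚ.< B → 0ℚ ℚ.< C → B ℚ.* δ ℚ.+ C ℚ.* δ ≡ ε →
      (∃ λ K → ∀ n → K ℕ.≤ n → ∣ u n ∣ ℚ.≤ B) →
      (∃ λ L → ∀ n → L ℕ.≤ n → ∣ v n ∣ ℚ.≤ C) →
      (∃ λ M → ∀ m n → M ℕ.≤ m → M ℕ.≤ n → ∣ u m ℚ.- u n ∣ ℚ.< δ) →
      (∃ λ N → ∀ m n → N ℕ.≤ m → N ℕ.≤ n → ∣ v m ℚ.- v n ∣ ℚ.< δ) →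
      Goal
    fromModuli B C δ 0<B 0<C Bδ+Cδ≡ε (K , ∣u∣≤B) (L , ∣v∣≤C) (M , p) (N , q) =
      (K ⊔ L) ⊔ (M ⊔ N) , λ m n ≤m ≤n →
        let K⊔L≤m = ℕ.m⊔n≤o⇒m≤o (K ⊔ L) (M ⊔ N) ≤m
            M⊔N≤m = ℕ.m⊔n≤o⇒n≤o (K ⊔ L) (M ⊔ N) ≤m
            K⊔L≤n = ℕ.m⊔n≤o⇒m≤o (K ⊔ L) (M ⊔ N) ≤n
            M⊔N≤n = ℕ.m⊔n≤o⇒n≤o (K ⊔ L) (M ⊔ N) ≤n
        in subst (∣ u m ℚ.* v m ℚ.- u n ℚ.* v n ∣ ℚ.<_) Bδ+Cδ≡ε
             (prod-close B C δ (u m) (v m) (u n) (v n) 0<B 0<C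
               (∣u∣≤B m (ℕ.m⊔n≤o⇒m≤o K L K⊔L≤m))
               (∣v∣≤C n (ℕ.m⊔n≤o⇒n≤o K L K⊔L≤n))
               (p m n (ℕ.m⊔n≤o⇒m≤o M N M⊔N≤m) (ℕ.m⊔n≤o⇒m≤o M N M⊔N≤n))
               (q m n (ℕ.m⊔n≤o⇒n≤o M N M⊔N≤m) (ℕ.m⊔n≤o⇒n≤o M N M⊔N≤n)))

    fromScale : ∀ B C → 0ℚ ℚ.< B → 0ℚ ℚ.< C →
      (∃ λ K → ∀ n → K ℕ.≤ n → ∣ u n ∣ ℚ.≤ B) →
      (∃ λ L → ∀ n → L ℕ.≤ n → ∣ v n ∣ ℚ.≤ C) →
      (∃ λ δ → 0ℚ ℚ.< δ × B ℚ.* δ ℚ.+ C ℚ.* δ ≡ ε) →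
      Goal
    fromScale B C 0<B 0<C ∣u∣≤B ∣v∣≤C (δ , 0<δ , Bδ+Cδ≡ε) =
      fromModuli B C δ 0<B 0<C Bδ+Cδ≡ε ∣u∣≤B ∣v∣≤C (u-cauchy δ 0<δ) (v-cauchy δ 0<δ)

    fromBounds :
      (∃ λ B → 0ℚ ℚ.< B × ∃ λ K → ∀ n → K ℕ.≤ n → ∣ u n ∣ ℚ.≤ B) →
      (∃ λ C → 0ℚ ℚ.< C × ∃ λ L → ∀ n → L ℕ.≤ n → ∣ v n ∣ ℚ.≤ C) →
      Goal
    fromBounds (B , 0<B , ∣u∣≤B) (C , 0<C , ∣v∣≤C) =
      fromScale B C 0<B 0<C ∣u∣≤B ∣v∣≤C (scale B C ε 0<B 0<C 0<ε)

fromℚ : ℚ → ℝ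
fromℚ q = mkℝ (λ _ → q) (const-cauchy q)

0ℝ : ℝ
0ℝ = fromℚ 0ℚ

_+_ : ℝ → ℝ → ℝ
x + y = mkℝ (λ n → seq x n ℚ.+ seq y n) (+-cauchy (seq x) (seq y) (cauchy x) (cauchy y))

-_ : ℝ → ℝ
- x = mkℝ (λ n → ℚ.- seq x n) (neg-cauchy (seq x) (cauchy x))

_-_ : ℝ → ℝ → ℝ
x - y = x + (- y)

_*_ : ℝ → ℝ → ℝ
x * y = mkℝ (λ n → seq x n ℚ.* seq y n) (*-cauchy (seq x) (seq y) (cauchy x) (cauchy y))

------------------------------------------------------------------------
-- Euclidean space

Point : ℕ → Set
Point n = Vector ℝ n

origin : ∀ {n} → Point n
origin _ = 0ℝ

distSq : ∀ {n} → Point n → Point n → ℝ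
distSq x y = foldr _+_ 0ℝ λ i → (x i - y i) * (x i - y i)

-- r = √ (Σᵢ (xᵢ - yᵢ)²), i.e. r is the nonnegative square root of the sum.
record IsDistance {n} (x y : Point n) (r : ℝ) : Set where
  field
    nonNegative : 0ℝ ≤ r
    square      : r * r ≈ distSq x y

-- Since ℝ is a setoid, a subset is a predicate that respects _≈_.
record Subset (n : ℕ) : Set₁ where
  field
    Mem     : Point n → Set
    respect : ∀ {x y} → (∀ i → x i ≈ y i) → Mem x → Mem y

infix 4 _∈_ _⊆_

_∈_ : ∀ {n} → Point n → Subset n → Set
x ∈ S = Subset.Mem S x

_⊆_ : ∀ {n} → Subset n → Subset n → Set
A ⊆ S = ∀ x → x ∈ A → x ∈ S

Bounded : ∀ {n} → Subset n → Set
Bounded S = ∃ λ R → ∀ x r → x ∈ S → IsDistance origin x r → r ≤ R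

BoundsDistances : ∀ {n} → Subset n → ℝ → Set
BoundsDistances S d = ∀ x y r → x ∈ S → y ∈ S → IsDistance x y r → r ≤ d

-- The supremum of the pairwise distances is taken in [0, ∞), so that the
-- empty set has diameter 0.
record IsDiameter {n} (S : Subset n) (d : ℝ) : Set where
  field
    nonNegative : 0ℝ ≤ d
    upperBound  : BoundsDistances S d
    least       : ∀ e → 0ℝ ≤ e → BoundsDistances S e → d ≤ e

record IsPartition {n m} (S : Subset n) (A : Fin m → Subset n) : Set where
  field
    subsets  : ∀ i → A i ⊆ S
    covers   : ∀ x → x ∈ S → ∃ λ i → x ∈ A i
    disjoint : ∀ x i j → x ∈ A i → x ∈ A j → i ≡ j

------------------------------------------------------------------------
-- Borsuk's problem

-- S has a partition into at most k subsets of diameter less than d.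
-- Empty parts are harmless, as d is positive below.
PartitionBelow : ∀ {n} → Subset n → ℝ → ℕ → Set₁
PartitionBelow {n} S d k =
  ∃ λ m → m ℕ.≤ k × Σ (Fin m → Subset n) λ A →
    IsPartition S A × (∀ i → ∃ λ e → IsDiameter (A i) e × e < d)

-- Every bounded set in ℝⁿ can be partitioned into at most k subsets of
-- strictly smaller diameter. The requirement 0 < d excludes the empty set and
-- single points; the latter have no such partition into any number of parts.
BorsukPartitionable : ℕ → ℕ → Set₁
BorsukPartitionable n k =
  ∀ (S : Subset n) d → Bounded S → IsDiameter S d → 0ℝ < d → PartitionBelow S d k

-- f is the number f(n) = min { k | BorsukPartitionable n k }.
record IsBorsukNumber (n f : ℕ) : Set₁ where
  field
    partitionable : BorsukPartitionable n f
    smallest      : ∀ k → BorsukPartitionable n k → f ℕ.≤ k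

-- f(n) ≥ m, as a lower bound on the set whose minimum is f(n). This does not
-- presuppose that the minimum can be computed; see ≥⇒IsBorsukNumber≥.
infix 4 f⟨_⟩≥_ f⟨_⟩>_

f⟨_⟩≥_ : ℕ → ℕ → Set₁
f⟨ n ⟩≥ m = ∀ k → BorsukPartitionable n k → m ℕ.≤ k

f⟨_⟩>_ : ℕ → ℕ → Set₁
f⟨ n ⟩> m = ∀ k → BorsukPartitionable n k → m ℕ.< k

≥⇒IsBorsukNumber≥ : ∀ {n m f} → f⟨ n ⟩≥ m → IsBorsukNumber n f → m ℕ.≤ f
≥⇒IsBorsukNumber≥ h b = h _ (IsBorsukNumber.partitionable b)

IsBorsukNumber≥⇒≥ : ∀ {n m f} → IsBorsukNumber n f → m ℕ.≤ f → f⟨ n ⟩≥ m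
IsBorsukNumber≥⇒≥ b m≤f k p = ℕ.≤-trans m≤f (IsBorsukNumber.smallest b k p)

{-# OPTIONS --safe #-}

-- The G₂(4) graph is strongly regular with parameters (416, 100, 36, 20) and has no clique
-- of 6 vertices. Bondarenko observed that it embeds as a two-distance set whose
-- non-adjacent pairs are the diametral ones, so a part of smaller diameter is a clique and
-- at least ⌈416 / 5⌉ = 84 parts are needed. If A is the adjacency matrix, 8 (4 I + A) has
-- rank 66; here it is realised as the Gram matrix of integer vectors in dimension 68, of
-- norm 32 and with non-adjacent ones orthogonal. Each further pair of dimensions holds two
-- vectors of norm 32 orthogonal to each other and to all others, and each of these requires
-- a part of its own. So at least 84 + 2 ⌊(n − 68) / 2⌋ ≥ n + 15 parts are needed in
-- dimension n. That there is no clique of 6 vertices is checked by exhaustive search.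

module Submission where

open import Data.Nat.Base using (ℕ) renaming (_+_ to _+ℕ_; _≥_ to _≥ℕ_)
open import Data.Product.Base using (_×_)

module PointSets where

  open import Data.Bool.Base using (Bool; true; false; T; not; _∧_)
  open import Data.Bool.ListAction using (all)
  open import Data.Bool.Properties using (T-∧; T-≡)
  open import Data.Fin.Base using (Fin; zero; suc; punchIn; punchOut)
  open import Data.Fin.Properties using (punchIn-punchOut)
  open import Data.List.Base using (List; []; _∷_; _++_; map; length; filterᵇ)
  open import Data.List.Membership.Propositional using (_∈_)
  open import Data.List.Membership.Propositional.Properties using (∈-map⁺)
  open import Data.List.Properties using (map-∘)
  open import Data.List.Relation.Binary.Sublist.Propositional using (_⊆_; []; _∷_; _∷ʳ_; ⊆-trans)
  open import Data.List.Relation.Unary.All as All using (All; []; _∷_)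
  import Data.List.Relation.Unary.All.Properties as All
  open import Data.List.Relation.Unary.AllPairs as AllPairs using (AllPairs; []; _∷_)
  import Data.List.Relation.Unary.AllPairs.Properties as AllPairs
  open import Data.List.Relation.Unary.Any using (here; there)
  open import Data.Nat.Base
  open import Data.Nat.DivMod using (_/_; _%_)
  open import Data.Nat.Properties
  open import Data.Product.Base using (∃; _,_; proj₁; proj₂)
  open import Data.Vec.Base using (Vec; []; _∷_; zipWith; replicate)
  open import Function.Base using (_∘_)
  open import Function.Bundles using (module Equivalence)
  open import Relation.Binary.Definitions using (Reflexive; Symmetric)
  open import Relation.Binary.PropositionalEquality
  open import Relation.Nullary.Negation using (contradiction)

  -- Squared distances between points with natural coordinates

  square : ℕ → ℕ
  square n = n * n

  dist² : ∀ {n} → Vec ℕ n → Vec ℕ n → ℕ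
  dist² []      []      = 0
  dist² (x ∷ p) (y ∷ q) = square ∣ x - y ∣ + dist² p q

  dist²-sym : ∀ {n} (p q : Vec ℕ n) → dist² p q ≡ dist² q p
  dist²-sym []      []      = refl
  dist²-sym (x ∷ p) (y ∷ q) = cong₂ _+_ (cong square (∣-∣-comm x y)) (dist²-sym p q)

  dist²-self : ∀ {n} (p : Vec ℕ n) → dist² p p ≡ 0
  dist²-self []      = refl
  dist²-self (x ∷ p) = cong₂ _+_ (cong square (∣n-n∣≡0 x)) (dist²-self p)

  -- Pairwise relations on lists and the pigeonhole principle

  module _ {A : Set} where

    AllPairs-lookup : {R : A → A → Set} → Reflexive R → Symmetric R →
      ∀ {xs x y} → AllPairs R xs → x ∈ xs → y ∈ xs → R x y
    AllPairs-lookup rfl sy (_   ∷ _)  (here refl) (here refl) = rfl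
    AllPairs-lookup rfl sy (Rx  ∷ _)  (here refl) (there y∈)  = All.lookup Rx y∈
    AllPairs-lookup rfl sy (Rx  ∷ _)  (there x∈)  (here refl) = sy (All.lookup Rx x∈)
    AllPairs-lookup rfl sy (_   ∷ Rs) (there x∈)  (there y∈)  = AllPairs-lookup rfl sy Rs x∈ y∈

    All⇒AllPairs : {P : A → Set} {R : A → A → Set} → (∀ {x y} → P x → P y → R x y) →
      ∀ {xs} → All P xs → AllPairs R xs
    All⇒AllPairs f []         = []
    All⇒AllPairs f (px ∷ pxs) = All.map (f px) pxs ∷ All⇒AllPairs f pxs

    private
      splitFirst : ∀ {m} (C : Fin (suc m) → A → Set) {xs} → All (λ x → ∃ λ c → C c x) xs →
        ∃ λ ys → ∃ λ zs → ys ⊆ xs × zs ⊆ xs × All (C zero) ys ×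
          All (λ x → ∃ λ c → C (suc c) x) zs × length ys + length zs ≡ length xs
      splitFirst C [] = [] , [] , [] , [] , [] , [] , refl
      splitFirst C {x ∷ _} ((c , h) ∷ hs) with splitFirst C hs | c | h
      ... | ys , zs , ys⊆ , zs⊆ , Cys , Czs , eq | zero  | h₀ =
        x ∷ ys , zs , refl ∷ ys⊆ , x ∷ʳ zs⊆ , h₀ ∷ Cys , Czs , cong suc eq
      ... | ys , zs , ys⊆ , zs⊆ , Cys , Czs , eq | suc d | h₁ =
        ys , x ∷ zs , x ∷ʳ ys⊆ , refl ∷ zs⊆ , Cys , (d , h₁) ∷ Czs ,
        trans (+-suc _ _) (cong suc eq)

    -- Membership in `C c` is not decidable, so each point is sorted by the class named in its own
    -- witness. `splitFirst` removes the points assigned to class `zero`, and the induction is on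
    -- the number of classes.
    pigeonhole : ∀ k {m} (C : Fin m → A → Set) {xs} →
      (∀ c {ys} → ys ⊆ xs → All (C c) ys → length ys ≤ k) →
      All (λ x → ∃ λ c → C c x) xs → length xs ≤ m * k
    pigeonhole k {zero}  C small []             = z≤n
    pigeonhole k {zero}  C small ((() , _) ∷ _)
    pigeonhole k {suc m} C small hs with splitFirst C hs
    ... | ys , zs , ys⊆ , zs⊆ , Cys , Czs , eq = subst (_≤ k + m * k) eq
      (+-mono-≤ (small zero ys⊆ Cys)
                (pigeonhole k (C ∘ suc) (λ c ws⊆ → small (suc c) (⊆-trans ws⊆ zs⊆)) Czs))

  -- Exhaustive search for cliques

  -- A graph is given by the rows of its adjacency matrix above the diagonal.

  upperRows : {A B : Set} → (A → A → B) → List A → List (List B)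
  upperRows f []       = []
  upperRows f (x ∷ xs) = map (f x) xs ∷ upperRows f xs

  keep : {A : Set} → List Bool → List A → List A
  keep (true  ∷ bs) (x ∷ xs) = x ∷ keep bs xs
  keep (false ∷ bs) (x ∷ xs) = keep bs xs
  keep _            _        = []

  induced : List Bool → List (List Bool) → List (List Bool)
  induced (true  ∷ bs) (r ∷ rs) = keep bs r ∷ induced bs rs
  induced (false ∷ bs) (r ∷ rs) = induced bs rs
  induced _            _        = []

  cliques≤ : ℕ → List (List Bool) → Bool
  cliques≤ k       []       = true
  cliques≤ zero    (_ ∷ _)  = false
  -- The row `r` doubles as the mask that selects the neighbours of the first vertex among the
  -- vertices of `rs`.
  cliques≤ (suc k) (r ∷ rs) = cliques≤ k (induced r rs) ∧ cliques≤ (suc k) rs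

  module _ {A : Set} where

    upperRows-map : {B C : Set} (g : B → C) (f : A → A → B) → ∀ xs →
      map (map g) (upperRows f xs) ≡ upperRows (λ x y → g (f x y)) xs
    upperRows-map g f []       = refl
    upperRows-map g f (x ∷ xs) = cong₂ _∷_ (sym (map-∘ xs)) (upperRows-map g f xs)

    upperRows-all : {B : Set} (p : B → Bool) (f : A → A → B) → ∀ xs →
      T (all (all p) (upperRows f xs)) → AllPairs (λ x y → T (p (f x y))) xs
    upperRows-all p f []       _ = []
    upperRows-all p f (x ∷ xs) h with Equivalence.to (T-∧ {all p (map (f x) xs)}) h
    ... | h₁ , h₂ = All.map⁻ (All.all⁺ p (map (f x) xs) h₁) ∷ upperRows-all p f xs h₂

    keep-map : {B : Set} (g : A → Bool) (f : A → B) → ∀ xs →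
      keep (map g xs) (map f xs) ≡ map f (filterᵇ g xs)
    keep-map g f []       = refl
    keep-map g f (x ∷ xs) with g x
    ... | true  = cong (f x ∷_) (keep-map g f xs)
    ... | false = keep-map g f xs

    induced-upperRows : (g : A → Bool) (f : A → A → Bool) → ∀ xs →
      induced (map g xs) (upperRows f xs) ≡ upperRows f (filterᵇ g xs)
    induced-upperRows g f []       = refl
    induced-upperRows g f (x ∷ xs) with g x
    ... | true  = cong₂ _∷_ (keep-map g (f x) xs) (induced-upperRows g f xs)
    ... | false = induced-upperRows g f xs

    ⊆-filterᵇ : (g : A → Bool) → ∀ {xs ys} → ys ⊆ xs → All (T ∘ g) ys → ys ⊆ filterᵇ g xs
    ⊆-filterᵇ g []         _        = []
    ⊆-filterᵇ g (x ∷ʳ τ)   gs       with g x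
    ... | true  = x ∷ʳ ⊆-filterᵇ g τ gs
    ... | false = ⊆-filterᵇ g τ gs
    ⊆-filterᵇ g {x ∷ _} (refl ∷ τ) (gx ∷ gs) with g x
    ... | true  = refl ∷ ⊆-filterᵇ g τ gs

    -- A clique either avoids the first vertex or consists of it and a clique among its neighbours,
    -- for which one vertex fewer is allowed.
    cliques≤-sound : (f : A → A → Bool) → ∀ k xs → T (cliques≤ k (upperRows f xs)) →
      ∀ {ys} → ys ⊆ xs → AllPairs (λ x y → T (f x y)) ys → length ys ≤ k
    cliques≤-sound f k       []       _ []         _  = z≤n
    cliques≤-sound f (suc k) (x ∷ xs) h τ          ys!
      with Equivalence.to (T-∧ {cliques≤ k (induced (map (f x) xs) (upperRows f xs))}) h
    cliques≤-sound f (suc k) (x ∷ xs) h (x ∷ʳ τ)   ys!        | _  , h₂ =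
      cliques≤-sound f (suc k) xs h₂ τ ys!
    cliques≤-sound f (suc k) (x ∷ xs) h (refl ∷ τ) (fx ∷ ys!) | h₁ , _  =
      s≤s (cliques≤-sound f k (filterᵇ (f x) xs)
        (subst (T ∘ cliques≤ k) (induced-upperRows (f x) f xs) h₁)
        (⊆-filterᵇ (f x) τ fx) ys!)

  -- Lower bounds on the number of parts, and configurations

  PartsBound : ∀ {n} → List (Vec ℕ n) → ℕ → Set₁
  PartsBound {n} pts K = ∀ {m} (C : Fin m → Vec ℕ n → Set) →
    -- 64 is the squared diameter 8² of every configuration, so no part may contain a diametral
    -- pair.
    (∀ {c p q} → C c p → C c q → dist² p q ≢ 64) →
    All (λ p → ∃ λ c → C c p) pts → K ≤ m

  -- The part `c₀` of the apex `q` can contain no point of `pts`. Deleting it and renumbering with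
  -- `punchOut` leaves a cover of `pts` with one part fewer.
  PartsBound-cone : ∀ {n} (q : Vec ℕ n) {pts K} → All (λ p → dist² q p ≡ 64) pts →
    PartsBound pts K → PartsBound (q ∷ pts) (suc K)
  PartsBound-cone q far bound {zero}  C C-small ((() , _) ∷ _)
  PartsBound-cone q far bound {suc m} C C-small ((c₀ , Cq) ∷ cs) =
    s≤s (bound (C ∘ punchIn c₀) C-small (All.zipWith avoid (far , cs)))
    where
    avoid : ∀ {p} → dist² q p ≡ 64 × (∃ λ c → C c p) → ∃ λ c → C (punchIn c₀ c) p
    avoid {p} (eq , c , Cp) = punchOut c₀≢c , subst (λ d → C d p) (sym (punchIn-punchOut c₀≢c)) Cp
      where
      c₀≢c : c₀ ≢ c
      c₀≢c refl = C-small Cq Cp eq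

  PartsBound-map : ∀ {m n} (f : Vec ℕ m → Vec ℕ n) → (∀ p q → dist² (f p) (f q) ≡ dist² p q) →
    ∀ {pts K} → PartsBound pts K → PartsBound (map f pts) K
  PartsBound-map f isometry bound C C-small cs =
    bound (λ c → C c ∘ f) (λ Cp Cq eq → C-small Cp Cq (trans (isometry _ _) eq)) (All.map⁻ cs)

  -- A set of diameter 8 on a sphere of squared radius 32 = 8² / 2, so that a point at
  -- distance √32 from the centre in an orthogonal direction has distance 8 from all of it.
  record Config (n K : ℕ) : Set₁ where
    field
      points    : List (Vec ℕ n)
      centre    : Vec ℕ n
      radius    : All (λ p → dist² centre p ≡ 32) points
      distances : AllPairs (λ p q → dist² p q ≤ 64) points
      attained  : ∃ λ p → ∃ λ q → p ∈ points × q ∈ points × dist² p q ≡ 64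
      parts     : PartsBound points K

    distance≤ : ∀ {p q} → p ∈ points → q ∈ points → dist² p q ≤ 64
    distance≤ = AllPairs-lookup {R = λ p q → dist² p q ≤ 64}
      (λ {p} → subst (_≤ 64) (sym (dist²-self p)) z≤n)
      (λ {p} {q} → subst (_≤ 64) (dist²-sym p q)) distances

  pad : ∀ {n K} → Config n K → Config (suc n) K
  pad cfg = record
    { points    = map (0 ∷_) points
    ; centre    = 0 ∷ centre
    ; radius    = All.map⁺ radius
    ; distances = AllPairs.map⁺ distances
    ; attained  = let p , q , p∈ , q∈ , eq = attained
                  in 0 ∷ p , 0 ∷ q , ∈-map⁺ (0 ∷_) p∈ , ∈-map⁺ (0 ∷_) q∈ , eq
    ; parts     = PartsBound-map (0 ∷_) (λ _ _ → refl) parts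
    }
    where open Config cfg

  addTwo : ∀ {n K} → Config n K → Config (2 + n) (2 + K)
  addTwo {n} {K} cfg = record
    { points    = a ∷ b ∷ map lift points
    ; centre    = lift centre
    ; radius    = cong (32 +_) (dist²-self centre) ∷ cong (32 +_) (dist²-self centre)
                ∷ All.map⁺ radius
    ; distances = All.map ≤-reflexive a-far ∷ All.map ≤-reflexive b-far
                ∷ AllPairs.map⁺ distances
    ; attained  = a , b , here refl , there (here refl) , All.head a-far
    ; parts     = PartsBound-cone a a-far (PartsBound-cone b b-far
                    (PartsBound-map lift (λ _ _ → refl) parts))
    }
    where
    open Config cfg

    lift : Vec ℕ n → Vec ℕ (2 + n)
    lift p = 4 ∷ 4 ∷ p

    -- Relative to the lifted centre, whose new coordinates are (4, 4), these are the orthogonal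
    -- vectors (4, 4) and (4, -4) of norm 32. The shift by 4 keeps the coordinates natural.
    a b : Vec ℕ (2 + n)
    a = 8 ∷ 8 ∷ centre
    b = 8 ∷ 0 ∷ centre

    b-far : All (λ p → dist² b p ≡ 64) (map lift points)
    b-far = All.map⁺ (All.map (cong (32 +_)) radius)

    a-far : All (λ p → dist² a p ≡ 64) (b ∷ map lift points)
    a-far = cong (64 +_) (dist²-self centre) ∷ All.map⁺ (All.map (cong (32 +_)) radius)

  weaken : ∀ {n K L} → L ≤ K → Config n K → Config n L
  weaken L≤K cfg = record
    { Config cfg
    ; parts = λ C C-small cs → ≤-trans L≤K (Config.parts cfg C C-small cs)
    }

  -- Reduction of the core to a Boolean check

  diametral : ℕ → Bool
  diametral d = d ≡ᵇ 64

  wellSpread : List (List ℕ) → Bool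
  wellSpread rows = all (all (_≤ᵇ 64)) rows ∧ cliques≤ 5 (map (map (not ∘ diametral)) rows)

  not-diametral : ∀ d → d ≢ 64 → T (not (diametral d))
  not-diametral d d≢64 with d ≡ᵇ 64 in eq
  ... | true  = contradiction (≡ᵇ⇒≡ d 64 (Equivalence.from T-≡ eq)) d≢64
  ... | false = _

  module _ {n} (pts : List (Vec ℕ n)) (ws : wellSpread (upperRows dist² pts) ≡ true) where
    private
      ws′ : T (all (all (_≤ᵇ 64)) (upperRows dist² pts)) ×
            T (cliques≤ 5 (map (map (not ∘ diametral)) (upperRows dist² pts)))
      ws′ = Equivalence.to (T-∧ {all (all (_≤ᵇ 64)) (upperRows dist² pts)})
              (Equivalence.from T-≡ ws)

    wellSpread-distances : AllPairs (λ p q → dist² p q ≤ 64) pts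
    wellSpread-distances =
      AllPairs.map (λ {p} {q} → ≤ᵇ⇒≤ (dist² p q) 64)
        (upperRows-all (_≤ᵇ 64) dist² pts (proj₁ ws′))

    -- The points sorted into one class form a clique of the non-diametral graph, so there are at
    -- most 5 of them. Equal entries would count as adjacent, so the clique bound also controls
    -- repetitions.
    wellSpread-parts : ∀ {m} (C : Fin m → Vec ℕ n → Set) →
      (∀ {c p q} → C c p → C c q → dist² p q ≢ 64) →
      All (λ p → ∃ λ c → C c p) pts → length pts ≤ m * 5
    wellSpread-parts C C-small = pigeonhole 5 C λ c τ Cys →
      cliques≤-sound (λ p q → not (diametral (dist² p q))) 5 pts
        (subst (T ∘ cliques≤ 5) (upperRows-map (not ∘ diametral) dist² pts) (proj₂ ws′))
        τ (All⇒AllPairs (λ {p} {q} Cp Cq → not-diametral (dist² p q) (C-small Cp Cq)) Cys)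

  -- Coordinates of the 416 points

  digits : ∀ k → ℕ → Vec ℕ k
  digits zero    n = []
  -- Numerals are read from right to left, and missing leading digits become 0. Points and sign
  -- changes are read alike, so their digits stay aligned.
  digits (suc k) n = n % 10 ∷ digits k (n / 10)

  -- The digits 1–9 are placed as on a numeric keypad: the corners are (±1, ±1), the edges
  -- (±2, 0) and (0, ±2), and 5 is the origin, all translated by (2, 2). Thus d ↦ 10 ∸ d is
  -- the reflection in the centre.
  column : ℕ → ℕ
  column 1 = 1
  column 2 = 2
  column 3 = 3
  column 4 = 0
  column 5 = 2
  column 6 = 4
  column 7 = 1
  column 8 = 2
  column _ = 3

  row : ℕ → ℕ
  row 1 = 1
  row 2 = 0
  row 3 = 1
  row 4 = 2
  row 5 = 2
  row 6 = 2
  row 7 = 3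
  row 8 = 4
  row _ = 3

  decode : ∀ {k} → Vec ℕ k → Vec ℕ (k * 2)
  decode []       = []
  decode (d ∷ ds) = column d ∷ row d ∷ decode ds

  -- The first argument is a digit of a sign change: 1 marks a plane on which it acts as -1, and 0 a
  -- plane that it fixes.
  reflectIf : ℕ → ℕ → ℕ
  reflectIf 0 d = d
  reflectIf _ d = 10 ∸ d

  orbit : ∀ {k} → List (Vec ℕ k) → List (Vec ℕ k) → List (Vec ℕ k)
  orbit []       ps = ps
  orbit (σ ∷ σs) ps = orbit σs ps ++ map (zipWith reflectIf σ) (orbit σs ps)

  -- The sign changes σ₀, …, σ₃ generate an elementary abelian group of automorphisms of
  -- order 16. It has 16 regular orbits of vertices, represented by the last group of
  -- numerals, and 40 orbits of size 4; on the latter it acts through a quotient of order 4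
  -- that depends on the orbit and is covered by two suitable generators.

  σ₀ : Vec ℕ 34
  σ₀ = digits 34 0000110011001100110011001100110011

  σ₁ : Vec ℕ 34
  σ₁ = digits 34 0000001111000011110000111100001111

  σ₂ : Vec ℕ 34
  σ₂ = digits 34 0000000000111111110000000011111111

  σ₃ : Vec ℕ 34
  σ₃ = digits 34 0000000000000000001111111111111111

  core : List (Vec ℕ 68)
  core = map (decode {34})
    ( orbit (σ₀ ∷ σ₁ ∷ []) (map (digits 34) (
        9931885555555555555555646255555555 ∷ 9931825555555555555555888655555555 ∷
        9931665555555555555555666855555555 ∷ 9931645555555555555555828455555555 ∷
        9197558855556455825555555555555555 ∷ 9197558255556655665555555555555555 ∷
        9197556655558255885555555555555555 ∷ 9197556455558855645555555555555555 ∷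
        9337555555558655555555845555555582 ∷ 9337555555558455555555685555555564 ∷
        9337555555556855555555865555555566 ∷ 9337555555556255555555625555555588 ∷
        9319555555555586555582555555555586 ∷ 9319555555555584555588555555555584 ∷
        9319555555555568555564555555555568 ∷ 9319555555555562555566555555555562 ∷ []))
    ++ orbit (σ₀ ∷ σ₂ ∷ []) (map (digits 34) (
        9971865555555555555555555584885555 ∷ 9971845555555555555555555568645555 ∷
        9971685555555555555555555586825555 ∷ 9971625555555555555555555562665555 ∷
        9193555586825555845555555555555555 ∷ 9193555584885555685555555555555555 ∷
        9193555568645555865555555555555555 ∷ 9193555562665555625555555555555555 ∷
        9373555555865555555584555555685555 ∷ 9373555555845555555562555555845555 ∷
        9373555555685555555568555555625555 ∷ 9373555555625555555586555555865555 ∷ []))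
    ++ orbit (σ₁ ∷ σ₃ ∷ []) (map (digits 34) (
        9777558655555555555555555564558255 ∷ 9777558455555555555555555588556455 ∷
        9777556855555555555555555566556655 ∷ 9777556255555555555555555582558855 ∷
        9733555588555555558255558855555555 ∷ 9733555582555555556455556455555555 ∷
        9733555566555555556655558255555555 ∷ 9733555564555555558855556655555555 ∷
        9719555555555588558655555555556855 ∷ 9719555555555582558455555555556255 ∷
        9719555555555566556855555555558655 ∷ 9719555555555564556255555555558455 ∷ []))
    ++ orbit (σ₀ ∷ σ₁ ∷ σ₂ ∷ σ₃ ∷ []) (map (digits 34) (
        9555959595959595959595959595959595 ∷ 9555957575753595957535757575753535 ∷
        9555955951595195955959595959515951 ∷ 9555955757575795955757575353535357 ∷
        9555759575575975355915531575595735 ∷ 9555757515595735755735597515535995 ∷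
        9555755957751575359559755953153557 ∷ 9555755759953535757553155751751551 ∷
        9555599559755751515715751559533559 ∷ 9555597557955959595975953557599553 ∷
        9555595995577559597559535915355715 ∷ 9555595735599551519557515375955175 ∷
        9555579557597553577595519557355153 ∷ 9555577551571553579575573551155359 ∷
        9555575935955757535759155975531575 ∷ 9555575715755157535953755795513515 ∷ []))
    )

  core-wellSpread : wellSpread (upperRows dist² core) ≡ true
  core-wellSpread = refl

  -- 40 orbits of size 4 and 16 of size 16.
  core-length : length core ≡ 416
  core-length = refl

  core-radius : all (λ p → dist² (replicate 68 2) p ≡ᵇ 32) core ≡ true
  core-radius = refl

  coreConfig : Config 68 84
  coreConfig = record
    { points    = core
    ; centre    = replicate 68 2
    ; radius    = All.map (λ {p} → ≡ᵇ⇒≡ (dist² (replicate 68 2) p) 32)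
                    (All.all⁺ (λ p → dist² (replicate 68 2) p ≡ᵇ 32) core
                      (Equivalence.from T-≡ core-radius))
    ; distances = wellSpread-distances core core-wellSpread
    -- The first and fifth entries are orthogonal about the centre, hence at squared distance 32 +
    -- 32.
    ; attained  = _ , _ , here refl , there (there (there (there (here refl)))) , refl
    -- 83 parts would hold at most 83 · 5 = 415 points.
    ; parts     = λ {m} C C-small cs → ≮⇒≥ λ m<84 → <⇒≱ (s≤s (*-monoˡ-≤ 5 (≤-pred m<84)))
                    (subst (_≤ m * 5) core-length
                      (wellSpread-parts core core-wellSpread C C-small cs))
    }

  -- The construction gives 84 + 2 ⌊k / 2⌋. This equals `83 + k` for odd k and exceeds it by 1 for
  -- even k, which is why the even case starts from a weakened core.
  config : ∀ k → Config (k + 68) (83 + k)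
  config zero          = weaken (n≤1+n 83) coreConfig
  config (suc zero)    = pad coreConfig
  config (suc (suc k)) = subst (Config (2 + k + 68)) eq (addTwo (config k))
    where
    eq : 2 + (83 + k) ≡ 83 + (2 + k)
    eq = sym (trans (+-suc 83 (suc k)) (cong suc (+-suc 83 k)))

open import Defs
open import Algebra.Bundles using (CommutativeRing)
import Algebra.Properties.Semiring.Mult as Mult
open import Data.Fin.Base using (Fin; zero; suc)
open import Data.List.Base using (map)
open import Data.List.Extrema.Nat using (max; xs≤max)
import Data.List.Membership.Propositional as List
import Data.List.Relation.Unary.All as All
import Data.List.Relation.Unary.All.Properties as All
import Data.Nat.Base as ℕ
import Data.Nat.Properties as ℕ
open import Data.Product.Base using (∃; _,_)
open import Data.Rational.Base as ℚ using (ℚ; 0ℚ; 1ℚ; ½; ∣_∣)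
import Data.Rational.Properties as ℚ
open import Data.Rational.Solver using (module +-*-Solver)
open import Data.Sum.Base using (inj₁; inj₂)
open import Data.Vec.Base using (Vec; []; _∷_; lookup; replicate)
open import Data.Vec.Properties using (lookup-replicate)
open import Relation.Binary.PropositionalEquality
open import Relation.Nullary.Decidable using (toWitness)
open import Relation.Nullary.Negation using (¬_)

open PointSets using (Config; dist²; square; config)
open Mult (CommutativeRing.semiring ℚ.+-*-commutativeRing)
  using (×-homo-+; ×1-homo-*) renaming (_×_ to _·_)

-- Natural numbers inside the rationals

ι : ℕ → ℚ
ι n = n · 1ℚ

ι-nonNeg : ∀ n → 0ℚ ℚ.≤ ι n
ι-nonNeg ℕ.zero    = ℚ.≤-refl
ι-nonNeg (ℕ.suc n) = ℚ.+-mono-≤ (ℚ.<⇒≤ (ℚ.positive⁻¹ 1ℚ)) (ι-nonNeg n)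

ι-mono : ∀ {m n} → m ℕ.≤ n → ι m ℚ.≤ ι n
ι-mono {n = n} ℕ.z≤n = ι-nonNeg n
ι-mono (ℕ.s≤s m≤n)   = ℚ.+-monoʳ-≤ 1ℚ (ι-mono m≤n)

-- The absolute difference of naturals agrees with the rational difference up to a sign, which
-- squaring removes.
ι-square-∣-∣ : ∀ a b → (ι a ℚ.- ι b) ℚ.* (ι a ℚ.- ι b) ≡ ι (square ℕ.∣ a - b ∣)
ι-square-∣-∣ ℕ.zero b = trans
  (solve 1 (λ x → (con 0ℚ :- x) :* (con 0ℚ :- x) := x :* x) refl (ι b)) (sym (×1-homo-* b b))
  where open +-*-Solver
ι-square-∣-∣ (ℕ.suc a) ℕ.zero = trans
  (solve 1 (λ x → (x :- con 0ℚ) :* (x :- con 0ℚ) := x :* x) refl (ι (ℕ.suc a)))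
  (sym (×1-homo-* (ℕ.suc a) (ℕ.suc a)))
  where open +-*-Solver
ι-square-∣-∣ (ℕ.suc a) (ℕ.suc b) = trans
  (cong (λ z → z ℚ.* z)
    (solve 2 (λ x y → (con 1ℚ :+ x) :- (con 1ℚ :+ y) := x :- y) refl (ι a) (ι b)))
  (ι-square-∣-∣ a b)
  where open +-*-Solver

-- Real numbers equal to rational constants, and order

pos* : ∀ {p q} → 0ℚ ℚ.< p → 0ℚ ℚ.< q → 0ℚ ℚ.< p ℚ.* q
pos* {p} {q} 0<p 0<q =
  ℚ.positive⁻¹ (p ℚ.* q) {{ℚ.pos*pos⇒pos p {{ℚ.positive 0<p}} q {{ℚ.positive 0<q}}}}

pos½ : ∀ {ε} → 0ℚ ℚ.< ε → 0ℚ ℚ.< ½ ℚ.* ε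
pos½ = pos* (ℚ.positive⁻¹ ½)

half+half : ∀ ε → ½ ℚ.* ε ℚ.+ ½ ℚ.* ε ≡ ε
half+half = solve 1 (λ e → con ½ :* e :+ con ½ :* e := e) refl
  where open +-*-Solver

<-halves : ∀ {a b c ε} → a ≡ b ℚ.+ c → ∣ b ∣ ℚ.< ½ ℚ.* ε → ∣ c ∣ ℚ.< ½ ℚ.* ε → ∣ a ∣ ℚ.< ε
<-halves {b = b} {c} {ε} refl b< c< = begin-strict
  ∣ b ℚ.+ c ∣          ≤⟨ ℚ.∣p+q∣≤∣p∣+∣q∣ b c ⟩
  ∣ b ∣ ℚ.+ ∣ c ∣      <⟨ ℚ.+-mono-< b< c< ⟩
  ½ ℚ.* ε ℚ.+ ½ ℚ.* ε  ≡⟨ half+half ε ⟩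
  ε                    ∎
  where open ℚ.≤-Reasoning

∣p-q∣≡∣q-p∣ : ∀ p q → ∣ p ℚ.- q ∣ ≡ ∣ q ℚ.- p ∣
∣p-q∣≡∣q-p∣ p q = trans (sym (ℚ.∣-p∣≡∣p∣ (p ℚ.- q)))
  (cong ∣_∣ (solve 2 (λ x y → :- (x :- y) := y :- x) refl p q))
  where open +-*-Solver

Eventually : (ℕ → Set) → Set
Eventually P = ∃ λ N → ∀ n → N ℕ.≤ n → P n

Eventually-map₂ : ∀ {P Q R : ℕ → Set} → (∀ n → P n → Q n → R n) →
  Eventually P → Eventually Q → Eventually R
Eventually-map₂ f (M , p) (N , q) = M ℕ.⊔ N , λ n M⊔N≤n →
  f n (p n (ℕ.m⊔n≤o⇒m≤o M N M⊔N≤n)) (q n (ℕ.m⊔n≤o⇒n≤o M N M⊔N≤n))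

open _≈_

≈-refl : ∀ {x} → x ≈ x
≈-refl {x} = mk≈ λ ε 0<ε →
  0 , λ n _ → subst (ℚ._< ε) (sym (cong ∣_∣ (ℚ.+-inverseʳ (seq x n)))) 0<ε

≈-sym : ∀ {x y} → x ≈ y → y ≈ x
≈-sym {x} {y} x≈y = mk≈ λ ε 0<ε → let N , p = close x≈y ε 0<ε in
  N , λ n N≤n → subst (ℚ._< ε) (∣p-q∣≡∣q-p∣ (seq x n) (seq y n)) (p n N≤n)

≈-trans : ∀ {x y z} → x ≈ y → y ≈ z → x ≈ z
≈-trans {x} {y} {z} x≈y y≈z = mk≈ λ ε 0<ε → Eventually-map₂
  (λ n → <-halves (split (seq x n) (seq y n) (seq z n)))
  (close x≈y _ (pos½ 0<ε)) (close y≈z _ (pos½ 0<ε))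
  where
  split : ∀ a b c → a ℚ.- c ≡ (a ℚ.- b) ℚ.+ (b ℚ.- c)
  split = solve 3 (λ a b c → a :- c := (a :- b) :+ (b :- c)) refl
    where open +-*-Solver

≈-+ : ∀ {x y} a b → x ≈ fromℚ a → y ≈ fromℚ b → x + y ≈ fromℚ (a ℚ.+ b)
≈-+ {x} {y} a b x≈a y≈b = mk≈ λ ε 0<ε → Eventually-map₂
  (λ n → <-halves (split (seq x n) (seq y n) a b))
  (close x≈a _ (pos½ 0<ε)) (close y≈b _ (pos½ 0<ε))
  where
  split : ∀ a b c d → (a ℚ.+ b) ℚ.- (c ℚ.+ d) ≡ (a ℚ.- c) ℚ.+ (b ℚ.- d)
  split = solve 4 (λ a b c d → (a :+ b) :- (c :+ d) := (a :- c) :+ (b :- d)) refl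
    where open +-*-Solver

≈-neg : ∀ {x} a → x ≈ fromℚ a → - x ≈ fromℚ (ℚ.- a)
≈-neg {x} a x≈a = mk≈ λ ε 0<ε → let N , p = close x≈a ε 0<ε in
  N , λ n N≤n → subst (ℚ._< ε) (flip (seq x n)) (p n N≤n)
  where
  flip : ∀ t → ∣ t ℚ.- a ∣ ≡ ∣ ℚ.- t ℚ.- ℚ.- a ∣
  flip t = trans (sym (ℚ.∣-p∣≡∣p∣ (t ℚ.- a)))
    (cong ∣_∣ (solve 2 (λ t a → :- (t :- a) := (:- t) :- (:- a)) refl t a))
    where open +-*-Solver

≈-square : ∀ {x} a → x ≈ fromℚ a → x * x ≈ fromℚ (a ℚ.* a)
≈-square {x} a x≈a = mk≈ λ ε 0<ε → Eventually-map₂ (λ n → near ε (seq x n))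
  (close x≈a 1ℚ (ℚ.positive⁻¹ 1ℚ)) (close x≈a (r ℚ.* ε) (pos* 0<r 0<ε))
  where
  B : ℚ
  -- Bounds |t + a| as soon as |t - a| < 1, by writing t + a as (t - a) + 2a.
  B = 1ℚ ℚ.+ (∣ a ∣ ℚ.+ ∣ a ∣)

  instance
    B-pos : ℚ.Positive B
    B-pos = ℚ.positive (ℚ.+-mono-<-≤ (ℚ.positive⁻¹ 1ℚ) (ℚ.+-mono-≤ (ℚ.0≤∣p∣ a) (ℚ.0≤∣p∣ a)))

    B-nonZero : ℚ.NonZero B
    B-nonZero = ℚ.pos⇒nonZero B

  r : ℚ
  r = ℚ.1/ B

  0<r : 0ℚ ℚ.< r
  0<r = ℚ.positive⁻¹ r {{ℚ.1/pos⇒pos B}}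

  factor : ∀ t a → t ℚ.* t ℚ.- a ℚ.* a ≡ ((t ℚ.- a) ℚ.+ (a ℚ.+ a)) ℚ.* (t ℚ.- a)
  factor = solve 2 (λ t a → t :* t :- a :* a := ((t :- a) :+ (a :+ a)) :* (t :- a)) refl
    where open +-*-Solver

  near : ∀ ε t → ∣ t ℚ.- a ∣ ℚ.< 1ℚ → ∣ t ℚ.- a ∣ ℚ.< r ℚ.* ε → ∣ t ℚ.* t ℚ.- a ℚ.* a ∣ ℚ.< ε
  near ε t <1 <rε = begin-strict
    ∣ t ℚ.* t ℚ.- a ℚ.* a ∣
      ≡⟨ trans (cong ∣_∣ (factor t a)) (ℚ.∣p*q∣≡∣p∣*∣q∣ ((t ℚ.- a) ℚ.+ (a ℚ.+ a)) (t ℚ.- a)) ⟩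
    ∣ (t ℚ.- a) ℚ.+ (a ℚ.+ a) ∣ ℚ.* ∣ t ℚ.- a ∣
      ≤⟨ ℚ.*-monoʳ-≤-nonNeg ∣ t ℚ.- a ∣ {{ℚ.nonNegative (ℚ.0≤∣p∣ (t ℚ.- a))}} bound ⟩
    B ℚ.* ∣ t ℚ.- a ∣
      <⟨ ℚ.*-monoʳ-<-pos B <rε ⟩
    B ℚ.* (r ℚ.* ε)
      ≡⟨ ℚ.*-assoc B r ε ⟨
    (B ℚ.* r) ℚ.* ε
      ≡⟨ cong (ℚ._* ε) (ℚ.*-inverseʳ B) ⟩
    1ℚ ℚ.* ε
      ≡⟨ ℚ.*-identityˡ ε ⟩
    ε ∎
    where
    open ℚ.≤-Reasoning
    bound : ∣ (t ℚ.- a) ℚ.+ (a ℚ.+ a) ∣ ℚ.≤ B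
    bound = ℚ.≤-trans (ℚ.∣p+q∣≤∣p∣+∣q∣ (t ℚ.- a) (a ℚ.+ a))
      (ℚ.+-mono-≤ (ℚ.<⇒≤ <1) (ℚ.∣p+q∣≤∣p∣+∣q∣ a a))

const-≤ : ∀ {p q} → p ℚ.≤ q → fromℚ p ≤ fromℚ q
const-≤ {p} {q} p≤q = mk≤ λ ε 0<ε → 0 , λ _ _ →
  subst (ℚ._< q ℚ.+ ε) (ℚ.+-identityʳ p) (ℚ.+-mono-≤-< p≤q 0<ε)

-- The gap of the strict inequality serves as the tolerance of the weak one.
≤⇒≯ : ∀ {x y} → x ≤ y → ¬ (y < x)
≤⇒≯ (mk≤ x≤y) (mk< gap 0<gap y<x) =
  let N , clash = Eventually-map₂ (λ _ → ℚ.<-asym) (x≤y gap 0<gap) y<x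
  in clash N ℕ.≤-refl

-- If a late term of `r` were at least b + ε, its square would be at least b² + ε² ≥ a + ε².
-- Closeness of r² to a within ε² excludes this.
square-≤ : ∀ {r} a b → r * r ≈ fromℚ a → 0ℚ ℚ.≤ b → a ℚ.≤ b ℚ.* b → r ≤ fromℚ b
square-≤ {r} a b r²≈a 0≤b a≤b² = mk≤ λ ε 0<ε →
  let N , near = close r²≈a (ε ℚ.* ε) (pos* 0<ε 0<ε) in
  N , λ n N≤n → ℚ.≰⇒> λ b+ε≤r → ℚ.<-irrefl refl (begin-strict
    seq r n ℚ.* seq r n
      ≡⟨ split (seq r n ℚ.* seq r n) a ⟩
    a ℚ.+ (seq r n ℚ.* seq r n ℚ.- a)
      ≤⟨ ℚ.+-monoʳ-≤ a (p≤∣p∣ _) ⟩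
    a ℚ.+ ∣ seq r n ℚ.* seq r n ℚ.- a ∣
      <⟨ ℚ.+-mono-≤-< a≤b² (near n N≤n) ⟩
    b ℚ.* b ℚ.+ ε ℚ.* ε
      ≤⟨ b²+ε²≤ ε 0<ε ⟩
    (b ℚ.+ ε) ℚ.* (b ℚ.+ ε)
      ≤⟨ square-mono (ℚ.<⇒≤ (ℚ.+-mono-≤-< 0≤b 0<ε)) b+ε≤r ⟩
    seq r n ℚ.* seq r n ∎)
  where
  open ℚ.≤-Reasoning

  split : ∀ x a → x ≡ a ℚ.+ (x ℚ.- a)
  split = solve 2 (λ x a → x := a :+ (x :- a)) refl
    where open +-*-Solver

  p≤∣p∣ : ∀ p → p ℚ.≤ ∣ p ∣
  p≤∣p∣ p with ℚ.≤-total 0ℚ p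
  ... | inj₁ 0≤p = ℚ.≤-reflexive (sym (ℚ.0≤p⇒∣p∣≡p 0≤p))
  ... | inj₂ p≤0 = ℚ.≤-trans p≤0 (ℚ.0≤∣p∣ p)

  square-mono : ∀ {p q} → 0ℚ ℚ.≤ p → p ℚ.≤ q → p ℚ.* p ℚ.≤ q ℚ.* q
  square-mono {p} {q} 0≤p p≤q = ℚ.≤-trans
    (ℚ.*-monoˡ-≤-nonNeg p {{ℚ.nonNegative 0≤p}} p≤q)
    (ℚ.*-monoʳ-≤-nonNeg q {{ℚ.nonNegative (ℚ.≤-trans 0≤p p≤q)}} p≤q)

  expand : ∀ b ε → (b ℚ.+ ε) ℚ.* (b ℚ.+ ε) ≡ (b ℚ.* b ℚ.+ ε ℚ.* ε) ℚ.+ b ℚ.* (ε ℚ.+ ε)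
  expand = solve 2 (λ b e → (b :+ e) :* (b :+ e) := (b :* b :+ e :* e) :+ b :* (e :+ e)) refl
    where open +-*-Solver

  b²+ε²≤ : ∀ ε → 0ℚ ℚ.< ε → b ℚ.* b ℚ.+ ε ℚ.* ε ℚ.≤ (b ℚ.+ ε) ℚ.* (b ℚ.+ ε)
  b²+ε²≤ ε 0<ε = begin
    b ℚ.* b ℚ.+ ε ℚ.* ε
      ≡⟨ ℚ.+-identityʳ _ ⟨
    (b ℚ.* b ℚ.+ ε ℚ.* ε) ℚ.+ 0ℚ
      ≤⟨ ℚ.+-monoʳ-≤ (b ℚ.* b ℚ.+ ε ℚ.* ε)
           (subst (ℚ._≤ b ℚ.* (ε ℚ.+ ε)) (ℚ.*-zeroʳ b)
             (ℚ.*-monoˡ-≤-nonNeg b {{ℚ.nonNegative 0≤b}} (ℚ.<⇒≤ (ℚ.+-mono-< 0<ε 0<ε)))) ⟩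
    (b ℚ.* b ℚ.+ ε ℚ.* ε) ℚ.+ b ℚ.* (ε ℚ.+ ε)
      ≡⟨ expand b ε ⟨
    (b ℚ.+ ε) ℚ.* (b ℚ.+ ε) ∎

-- Embedding natural points in Euclidean space

embed : ∀ {n} → Vec ℕ n → Point n
embed p i = fromℚ (ι (lookup p i))

_≋_ : ∀ {n} → Point n → Point n → Set
x ≋ y = ∀ i → x i ≈ y i

-- Stated up to `≋` because a subset must respect `≈`: the members of the set built below are only
-- equal to embedded points in this sense.
distSq-embed : ∀ {n} {x y : Point n} p q → x ≋ embed p → y ≋ embed q →
  distSq x y ≈ fromℚ (ι (dist² p q))
distSq-embed []      []      x≋ y≋ = ≈-refl
distSq-embed {x = x} {y} (a ∷ p) (b ∷ q) x≋ y≋ =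
  subst (λ c → distSq x y ≈ fromℚ c)
    (sym (trans (×-homo-+ 1ℚ (square ℕ.∣ a - b ∣) (dist² p q))
                (cong (ℚ._+ ι (dist² p q)) (sym (ι-square-∣-∣ a b)))))
    (≈-+ ((ι a ℚ.- ι b) ℚ.* (ι a ℚ.- ι b)) (ι (dist² p q))
      (≈-square (ι a ℚ.- ι b) (≈-+ (ι a) (ℚ.- ι b) (x≋ zero) (≈-neg (ι b) (y≋ zero))))
      (distSq-embed p q (λ i → x≋ (suc i)) (λ i → y≋ (suc i))))

distance-≤ : ∀ {n} {x y : Point n} {r} p q (δ : ℕ) → dist² p q ℕ.≤ δ ℕ.* δ →
  x ≋ embed p → y ≋ embed q → IsDistance x y r → r ≤ fromℚ (ι δ)
distance-≤ p q δ p~q x≋p y≋q r-dist =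
  square-≤ (ι (dist² p q)) (ι δ)
    (≈-trans (IsDistance.square r-dist) (distSq-embed p q x≋p y≋q))
    (ι-nonNeg δ)
    (subst (ι (dist² p q) ℚ.≤_) (×1-homo-* δ δ) (ι-mono p~q))

distance-≡ : ∀ {n} (p q : Vec ℕ n) (δ : ℕ) → dist² p q ≡ δ ℕ.* δ →
  IsDistance (embed p) (embed q) (fromℚ (ι δ))
distance-≡ p q δ eq = record
  { nonNegative = const-≤ (ι-nonNeg δ)
  ; square      = ≈-trans δ²≈ (≈-sym (distSq-embed p q (λ _ → ≈-refl) (λ _ → ≈-refl)))
  }
  where
  δ²≈ : fromℚ (ι δ) * fromℚ (ι δ) ≈ fromℚ (ι (dist² p q))
  δ²≈ = subst (λ a → fromℚ (ι δ) * fromℚ (ι δ) ≈ fromℚ a)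
    (trans (sym (×1-homo-* δ δ)) (cong ι (sym eq))) (≈-square (ι δ) ≈-refl)

-- From configurations to Borsuk numbers

Config⇒f≥ : ∀ {n K} → Config n K → f⟨ n ⟩≥ K
Config⇒f≥ {n} {K} cfg k partitionable =
  let m , m≤k , A , isPartition , small = partitionable S d bounded diameter 0<d
  in ℕ.≤-trans (parts (λ c p → embed p ∈ A c) (λ {c} {p} {q} → same-part A small c p q)
       (All.tabulate λ {p} p∈ → IsPartition.covers isPartition (embed p) (p , p∈ , λ _ → ≈-refl)))
       m≤k
  where
  open Config cfg

  S : Subset n
  S = record
    { Mem     = λ x → ∃ λ p → p List.∈ points × x ≋ embed p
    ; respect = λ x≋y (p , p∈ , x≋p) → p , p∈ , λ i → ≈-trans (≈-sym (x≋y i)) (x≋p i)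
    }

  d : ℝ
  d = fromℚ (ι 8)

  0<d : 0ℝ < d
  0<d = mk< 1ℚ (ℚ.positive⁻¹ 1ℚ) (0 , λ _ _ → toWitness {a? = _ ℚ.<? _} _)

  origin≋ : origin ≋ embed (replicate n 0)
  origin≋ i = subst (λ a → 0ℝ ≈ fromℚ (ι a)) (sym (lookup-replicate i 0)) ≈-refl

  bounded : Bounded S
  bounded = fromℚ (ι R) , λ x r (p , p∈ , x≋p) → distance-≤ (replicate n 0) p R
    (ℕ.≤-trans (All.lookup (All.map⁻ (xs≤max 0 (map (dist² (replicate n 0)) points))) p∈) (R≤R² R))
    origin≋ x≋p
    where
    R : ℕ
    -- A maximum of squared distances. As `R` ≤ `R`² for naturals, it bounds the distances too,
    -- without a square root.
    R = max 0 (map (dist² (replicate n 0)) points)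

    R≤R² : ∀ R → R ℕ.≤ R ℕ.* R
    R≤R² ℕ.zero    = ℕ.z≤n
    R≤R² (ℕ.suc R) = ℕ.m≤m*n (ℕ.suc R) (ℕ.suc R)

  diameter : IsDiameter S d
  diameter = record
    { nonNegative = const-≤ (ι-nonNeg 8)
    ; upperBound  = λ x y r (p , p∈ , x≋p) (q , q∈ , y≋q) →
                      distance-≤ p q 8 (distance≤ p∈ q∈) x≋p y≋q
    ; least       = λ e _ bounds → let p , q , p∈ , q∈ , eq = attained in
                      bounds (embed p) (embed q) d (p , p∈ , λ _ → ≈-refl) (q , q∈ , λ _ → ≈-refl)
                        (distance-≡ p q 8 eq)
    }

  same-part : ∀ {m} (A : Fin m → Subset n) → (∀ i → ∃ λ e → IsDiameter (A i) e × e < d) →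
    ∀ c p q → embed p ∈ A c → embed q ∈ A c → dist² p q ≢ 64
  -- A pair at squared distance 64 would force the diameter of the part up to 8 = `d`.
  same-part A small c p q p∈ q∈ eq = let e , e-diameter , e<d = small c in
    ≤⇒≯ (IsDiameter.upperBound e-diameter (embed p) (embed q) d p∈ q∈ (distance-≡ p q 8 eq)) e<d

theorem1 : (f⟨ 321 ⟩≥ 333) × ((n : ℕ) → n ≥ℕ 321 → f⟨ n ⟩> (n +ℕ 1))
theorem1 =
  -- Here 321 = 253 + 68, and the bound obtained is 83 + 253 = 336 = 333 + 3.
  (λ k partitionable → ℕ.≤-trans (ℕ.m≤m+n 333 3) (Config⇒f≥ (config 253) k partitionable)) ,
  λ n n≥321 k partitionable →
    let m = n ℕ.∸ 68
        m+68≡n = ℕ.m∸n+n≡m (ℕ.≤-trans (ℕ.m≤m+n 68 253) n≥321)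
    in ℕ.≤-trans (exceeds m n m+68≡n)
         (Config⇒f≥ (config m) k (subst (λ j → BorsukPartitionable j k) (sym m+68≡n) partitionable))
  where
  -- With n = m + 68, the strict inequality amounts to m + 70 ≤ m + 83.
  exceeds : ∀ m n → m ℕ.+ 68 ≡ n → n +ℕ 1 ℕ.< 83 ℕ.+ m
  exceeds m _ refl = begin
    ℕ.suc (m ℕ.+ 68 ℕ.+ 1)  ≡⟨ cong ℕ.suc (ℕ.+-assoc m 68 1) ⟩
    ℕ.suc (m ℕ.+ 69)        ≡⟨ ℕ.+-suc m 69 ⟨
    m ℕ.+ 70                ≡⟨ ℕ.+-comm m 70 ⟩
    70 ℕ.+ m                ≤⟨ ℕ.+-monoˡ-≤ m (ℕ.m≤m+n 70 13) ⟩
    83 ℕ.+ m                ∎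
    where open ℕ.≤-Reasoning
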